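{- Let $n<\omega$, let $L\in\mathbf{M}_n$ and let $P$ be its dual $pm$-space. Then every order component of $P$ is a closed subset of $P$.
   Context: $\mathbf{M}_n$ is the variety of regular pseudocomplemented de Morgan algebras of range $n$: algebras $(L;\wedge,\vee,{}^\ast,{}^\prime,0,1)$ with bounded distributive lattice reduct, pseudocomplement ${}^\ast$, de Morgan involution ${}^\prime$, satisfying $x\wedge x^{\prime\ast\prime}\le y\vee y^\ast$ (regularity) and $(x\wedge x^{\prime\ast})^{n(\prime\ast)}=(x\wedge x^{\prime\ast})^{(n+1)(\prime\ast)}$, where $x^{0(\prime\ast)}=x$, $x^{(k+1)(\prime\ast)}=((x^{k(\prime\ast)})')^\ast$. The dual $pm$-space is the Priestley space $(P;\tau,\le)$ of prime ideals with the involution $\zeta(I)=\{a:a'\notin I\}$. An order component of $P$ is a maximal subset any two elements of which are joined by a finite path in the comparability graph of $(P;\le)$. -}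

module Defs where

open import Level using (Level; _⊔_) renaming (suc to lsuc)
open import Algebra.Core using (Op₁; Op₂)
open import Algebra.Definitions using (LeftIdentity; Congruent₁; Involutive)
open import Algebra.Lattice.Bundles using (DistributiveLattice)
import Algebra.Lattice.Properties.Lattice as LatticeProperties
open import Algebra.Lattice.Structures using (IsDistributiveLattice)
open import Axiom.ExcludedMiddle using (ExcludedMiddle)
open import Data.List.Base using (List; []; _∷_; _++_)
open import Data.List.Relation.Unary.All using (All; []; _∷_)
open import Data.List.Relation.Unary.All.Properties using (++⁺; ++⁻ˡ; ++⁻ʳ)
open import Data.Nat.Base using (ℕ; zero; suc)
open import Data.Product using (Σ-syntax; ∃; _×_; _,_; proj₁; proj₂)
open import Data.Sum.Base using (_⊎_; inj₁; inj₂)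
open import Data.Unit.Polymorphic using (⊤)
open import Function.Bundles using (_⇔_)
open import Relation.Binary.Bundles using (Poset)
open import Relation.Binary.Core using (Rel)
open import Relation.Binary.Construct.Closure.Equivalence using (EqClosure)
import Relation.Binary.Construct.NaturalOrder.Left as NaturalOrder
import Relation.Binary.Reasoning.Setoid as SetoidReasoning
open import Relation.Nullary using (¬_; yes; no)
open import Relation.Nullary.Decidable using (decidable-stable)
open import Relation.Unary using (Pred; _∈_; _∉_; _⊆_; _∩_; ∁)

private
  variable
    a b i p r s t c ℓ ℓ₁ ℓ₂ : Level

-- The mathematics is classical, so this and ExcludedMiddle are taken as
-- hypotheses.  With Σ-type existence ExcludedMiddle already selects elements of
-- non-empty types, but not compatibly with extensional equality of predicates,
-- which choice over predicates requires.
-- The chain condition covers the empty chain, so O is inhabited.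
ZornsLemma : ∀ a ℓ₁ ℓ₂ s → Set (lsuc (a ⊔ ℓ₁ ⊔ ℓ₂ ⊔ s))
ZornsLemma a ℓ₁ ℓ₂ s =
  (O : Poset a ℓ₁ ℓ₂) → let open Poset O in
  ((C : Pred Carrier s) →
     (∀ {x y} → x ∈ C → y ∈ C → x ≤ y ⊎ y ≤ x) →
     ∃ λ u → ∀ {x} → x ∈ C → x ≤ u) →
  ∃ λ m → ∀ {x} → m ≤ x → m ≈ x

record PMAlgebra c ℓ : Set (lsuc (c ⊔ ℓ)) where
  infix  4 _≈_ _≤_
  infixr 7 _∧_
  infixr 6 _∨_
  infixl 8 _* _′
  field
    Carrier : Set c
    _≈_     : Rel Carrier ℓ
    _∧_ _∨_ : Op₂ Carrier
    _* _′   : Op₁ Carrier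
    0# 1#   : Carrier

  _≤_ : Rel Carrier ℓ
  _≤_ = NaturalOrder._≤_ _≈_ _∧_

  field
    isDistributiveLattice : IsDistributiveLattice _≈_ _∨_ _∧_
    0-identityˡ           : LeftIdentity _≈_ 0# _∨_
    1-identityˡ           : LeftIdentity _≈_ 1# _∧_
    *-pseudocomplement    : ∀ x y → (x ∧ y ≈ 0#) ⇔ (y ≤ x *)
    ′-cong                : Congruent₁ _≈_ _′
    ′-involutive          : Involutive _≈_ _′
    ′-deMorgan            : ∀ x y → (x ∧ y) ′ ≈ x ′ ∨ y ′

  open IsDistributiveLattice isDistributiveLattice public

  distributiveLattice : DistributiveLattice c ℓ
  distributiveLattice = record { isDistributiveLattice = isDistributiveLattice }

  -- iter k x is x^{k(′*)}.
  iter : ℕ → Carrier → Carrier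
  iter zero    x = x
  iter (suc k) x = iter k x ′ *

  Regular : Set (c ⊔ ℓ)
  Regular = ∀ x y → x ∧ x ′ * ′ ≤ y ∨ y *

  HasRange : ℕ → Set (c ⊔ ℓ)
  HasRange n = ∀ x → iter n (x ∧ x ′ *) ≈ iter (suc n) (x ∧ x ′ *)

_∈𝐌_ : PMAlgebra c ℓ → ℕ → Set (c ⊔ ℓ)
L ∈𝐌 n = Regular × HasRange n
  where open PMAlgebra L

record InvolutiveOrderedSpace p r s t : Set (lsuc (p ⊔ r ⊔ s ⊔ t)) where
  field
    poset : Poset p r r

  open Poset poset public renaming (Carrier to Point)

  field
    Open        : Pred (Pred Point s) t
    open-resp   : ∀ {U V} → U ⊆ V → V ⊆ U → Open U → Open V
    open-whole  : Open (λ _ → ⊤)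
    open-∩      : ∀ {U V} → Open U → Open V → Open (U ∩ V)
    open-⋃      : ∀ {I : Set s} (U : I → Pred Point s) →
                  (∀ j → Open (U j)) → Open (λ x → ∃ λ j → x ∈ U j)
    ζ           : Op₁ Point
    ζ-antitone  : ∀ {x y} → x ≤ y → ζ y ≤ ζ x
    ζ-involutive : Involutive _≈_ ζ

  Closed : Pred Point s → Set t
  Closed S = Open (∁ S)

  -- The symmetric closure of _≤_ is comparability, so EqClosure _≤_ is the
  -- type of finite paths in the comparability graph.
  PairwiseJoined : Pred Point s → Set (p ⊔ r ⊔ s)
  PairwiseJoined S = ∀ {x y} → x ∈ S → y ∈ S → EqClosure _≤_ x y

  IsOrderComponent : Pred Point s → Set (p ⊔ r ⊔ lsuc s)
  IsOrderComponent S =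
    PairwiseJoined S ×
    (∀ (T : Pred Point s) → S ⊆ T → PairwiseJoined T → T ⊆ S)

module _ {X : Set a} {I : Set i} (B : I → Pred X b) where

  ⋂ : List I → Pred X (i ⊔ b)
  ⋂ js x = All (λ j → x ∈ B j) js

  -- The topology with subbase B: U is open iff around each of its points it
  -- contains a finite intersection of members of B.
  Generated : Pred (Pred X s) (a ⊔ i ⊔ b ⊔ s)
  Generated U = ∀ {x} → x ∈ U → Σ[ js ∈ List I ] (x ∈ ⋂ js × ⋂ js ⊆ U)

module _ (L : PMAlgebra c ℓ) where
  open PMAlgebra L

  record PrimeIdeal : Set (lsuc (c ⊔ ℓ)) where
    field
      ⟦_⟧      : Pred Carrier (c ⊔ ℓ)
      0∈       : 0# ∈ ⟦_⟧
      1∉       : 1# ∉ ⟦_⟧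
      down     : ∀ {x y} → x ≤ y → y ∈ ⟦_⟧ → x ∈ ⟦_⟧
      ∨-closed : ∀ {x y} → x ∈ ⟦_⟧ → y ∈ ⟦_⟧ → x ∨ y ∈ ⟦_⟧
      prime    : ∀ {x y} → x ∧ y ∈ ⟦_⟧ → x ∈ ⟦_⟧ ⊎ y ∈ ⟦_⟧

  open PrimeIdeal

  inclusionPoset : Poset (lsuc (c ⊔ ℓ)) (c ⊔ ℓ) (c ⊔ ℓ)
  inclusionPoset = record
    { Carrier        = PrimeIdeal
    ; _≈_            = λ I J → (⟦ I ⟧ ⊆ ⟦ J ⟧) × (⟦ J ⟧ ⊆ ⟦ I ⟧)
    ; _≤_            = λ I J → ⟦ I ⟧ ⊆ ⟦ J ⟧
    ; isPartialOrder = record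
      { isPreorder = record
        { isEquivalence = record
          { refl  = (λ z → z) , (λ z → z)
          ; sym   = λ (f , g) → g , f
          ; trans = λ (f , g) (f′ , g′) → (λ z → f′ (f z)) , (λ z → g (g′ z))
          }
        ; reflexive = λ {I} {J} → proj₁
        ; trans     = λ f g z → g (f z)
        }
      ; antisym = _,_
      }
    }

  subbase : Carrier ⊎ Carrier → Pred PrimeIdeal (c ⊔ ℓ)
  subbase (inj₁ x) I = x ∈ ⟦ I ⟧
  subbase (inj₂ x) I = x ∉ ⟦ I ⟧

  private
    open LatticeProperties (DistributiveLattice.lattice distributiveLattice) using (∧-idem)
    open SetoidReasoning (DistributiveLattice.setoid distributiveLattice)

    down-≈ : ∀ I {x y} → x ≈ y → y ∈ ⟦ I ⟧ → x ∈ ⟦ I ⟧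
    down-≈ I {x} {y} x≈y = down I (begin
      x      ≈⟨ ∧-idem x ⟨
      x ∧ x  ≈⟨ ∧-cong refl x≈y ⟩
      x ∧ y  ∎)

    ′-deMorgan-∨ : ∀ x y → (x ∨ y) ′ ≈ x ′ ∧ y ′
    ′-deMorgan-∨ x y = begin
      (x ∨ y) ′           ≈⟨ ′-cong (∨-cong (′-involutive x) (′-involutive y)) ⟨
      (x ′ ′ ∨ y ′ ′) ′   ≈⟨ ′-cong (′-deMorgan (x ′) (y ′)) ⟨
      (x ′ ∧ y ′) ′ ′     ≈⟨ ′-involutive (x ′ ∧ y ′) ⟩
      x ′ ∧ y ′           ∎

    ′-antitone : ∀ {x y} → x ≤ y → y ′ ≤ x ′
    ′-antitone {x} {y} x≤y = begin
      y ′              ≈⟨ ∧-absorbs-∨ (y ′) (x ′) ⟨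
      y ′ ∧ (y ′ ∨ x ′) ≈⟨ ∧-cong refl (∨-comm (y ′) (x ′)) ⟩
      y ′ ∧ (x ′ ∨ y ′) ≈⟨ ∧-cong refl (′-deMorgan x y) ⟨
      y ′ ∧ (x ∧ y) ′  ≈⟨ ∧-cong refl (′-cong x≤y) ⟨
      y ′ ∧ x ′        ∎

    1′≈0 : 1# ′ ≈ 0#
    1′≈0 = begin
      1# ′                ≈⟨ 0-identityˡ (1# ′) ⟨
      0# ∨ 1# ′           ≈⟨ ∨-cong (′-involutive 0#) refl ⟨
      0# ′ ′ ∨ 1# ′       ≈⟨ ′-deMorgan (0# ′) 1# ⟨
      (0# ′ ∧ 1#) ′       ≈⟨ ′-cong (∧-comm (0# ′) 1#) ⟩
      (1# ∧ 0# ′) ′       ≈⟨ ′-cong (1-identityˡ (0# ′)) ⟩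
      0# ′ ′              ≈⟨ ′-involutive 0# ⟩
      0#                  ∎

    0′≈1 : 0# ′ ≈ 1#
    0′≈1 = trans (′-cong (sym 1′≈0)) (′-involutive 1#)

  -- Primality of ζ(I) is where excluded middle is needed.
  involute : ExcludedMiddle (c ⊔ ℓ) → Op₁ PrimeIdeal
  involute em I = record
    { ⟦_⟧      = λ x → x ′ ∉ ⟦ I ⟧
    ; 0∈       = λ 0′∈I → 1∉ I (down-≈ I (sym 0′≈1) 0′∈I)
    ; 1∉       = λ 1′∉I → 1′∉I (down-≈ I 1′≈0 (0∈ I))
    ; down     = λ x≤y y′∉I x′∈I → y′∉I (down I (′-antitone x≤y) x′∈I)
    ; ∨-closed = λ {x} {y} x′∉I y′∉I xy′∈I →
        case-⊎ x′∉I y′∉I (prime I (down-≈ I (sym (′-deMorgan-∨ x y)) xy′∈I))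
    ; prime    = λ {x} {y} xy′∉I → split x y xy′∉I
    }
    where
    case-⊎ : ∀ {x y} → x ∉ ⟦ I ⟧ → y ∉ ⟦ I ⟧ → ¬ (x ∈ ⟦ I ⟧ ⊎ y ∈ ⟦ I ⟧)
    case-⊎ x∉ y∉ (inj₁ x∈) = x∉ x∈
    case-⊎ x∉ y∉ (inj₂ y∈) = y∉ y∈

    split : ∀ x y → (x ∧ y) ′ ∉ ⟦ I ⟧ → x ′ ∉ ⟦ I ⟧ ⊎ y ′ ∉ ⟦ I ⟧
    split x y xy′∉I with em {x ′ ∈ ⟦ I ⟧}
    ... | no  x′∉I = inj₁ x′∉I
    ... | yes x′∈I = inj₂ λ y′∈I →
      xy′∉I (down-≈ I (′-deMorgan x y) (∨-closed I x′∈I y′∈I))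

  dualSpace : ExcludedMiddle (c ⊔ ℓ) →
              InvolutiveOrderedSpace (lsuc (c ⊔ ℓ)) (c ⊔ ℓ) (lsuc (c ⊔ ℓ)) (lsuc (c ⊔ ℓ))
  dualSpace em = record
    { poset      = inclusionPoset
    ; Open       = Generated subbase
    ; open-resp  = λ U⊆V V⊆U openU x∈V →
        let js , x∈B , B⊆U = openU (V⊆U x∈V) in js , x∈B , λ y∈B → U⊆V (B⊆U y∈B)
    ; open-whole = λ _ → [] , [] , _
    ; open-∩     = λ openU openV (x∈U , x∈V) →
        let js , x∈B , B⊆U = openU x∈U
            ks , x∈C , C⊆V = openV x∈V
        in js ++ ks , ++⁺ x∈B x∈C , λ z → B⊆U (++⁻ˡ js z) , C⊆V (++⁻ʳ js z)
    ; open-⋃     = λ U openU (j , x∈Uj) →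
        let js , x∈B , B⊆U = openU j x∈Uj in js , x∈B , λ z → j , B⊆U z
    ; ζ          = involute em
    ; ζ-antitone = λ I⊆J x′∉J x′∈I → x′∉J (I⊆J x′∈I)
    ; ζ-involutive = λ I →
        (λ {x} nn → down-≈ I (sym (′-involutive x)) (decidable-stable em nn)) ,
        (λ {x} x∈I x″∉I → x″∉I (down-≈ I (′-involutive x) x∈I))
    }

{-# OPTIONS --safe #-}

-- Write J ⊑ₖ I when a ∈ J implies a^{k(′*)} ∈ I.  By the prime ideal theorem,
-- J ⊑ₖ₊₁ I yields a prime ideal M ⊆ ζ(J) with M ⊑ₖ I, so J ⊑ₖ I implies that J
-- lies in the order component of ζᵏ(I).  Conversely every J in the component of
-- I satisfies J ⊑ₖ I for some k, because a ∨ a′*′ = 1 turns a step up from J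
-- into two more applications of ′*.  Finite range bounds k: if J ⊑ₖ I, then
-- J ⊑ₙ I or J ⊑ₙ₊₁ I, as the iterates of (a ∨ b) ∧ (a ∨ b)′* decrease and become
-- constant at n.  Let K lie outside the component S of I.  For j = n, n + 1, either
-- K ⋢ⱼ I, witnessed by a single element of K, or K lies in the component of
-- ζʲ(I), so that no J ∈ S has J ⊑ⱼ I.  Hence at most two elements of K determine
-- a neighbourhood of K missing S.

module Submission where

open import Defs
open import Axiom.ExcludedMiddle using (ExcludedMiddle)
open import Data.Nat.Base using (ℕ)
open import Level using (_⊔_; suc)
open import Relation.Unary using (Pred)

open import Algebra.Lattice.Bundles using (DistributiveLattice)
import Algebra.Lattice.Properties.Lattice as LatticeProperties
open import Data.Empty using (⊥-elim)
open import Data.Empty.Polymorphic using (⊥)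
open import Data.List.Base using ([]; _∷_)
open import Data.List.Relation.Unary.All using ([]; _∷_)
import Data.Nat.Base as ℕ
open import Data.Nat.Properties using (+-comm)
open import Data.Product using (∃; _×_; _,_; proj₁; proj₂)
open import Data.Sum.Base as Sum using (_⊎_; inj₁; inj₂; [_,_]′)
open import Data.Unit.Polymorphic using (⊤)
open import Function.Base using (id; _∘_)
open import Function.Bundles using (module Equivalence)
import Level
open import Relation.Binary.Bundles using (Poset)
open import Relation.Binary.Construct.Closure.Equivalence using (EqClosure; symmetric)
open import Relation.Binary.Construct.Closure.ReflexiveTransitive as Star
  using (ε; _◅_; _◅◅_)
open import Relation.Binary.Construct.Closure.Symmetric using (fwd; bwd)
import Relation.Binary.Lattice.Bundles as Order
open import Relation.Binary.PropositionalEquality using (_≡_; cong; subst)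
  renaming (refl to ≡-refl; sym to ≡-sym)
open import Relation.Nullary using (¬_; yes; no)
open import Relation.Nullary.Decidable using (decidable-stable)
open import Relation.Unary using (_∈_; _∉_; _⊆_)

module _ {c ℓ} (L : PMAlgebra c ℓ) where
  open PMAlgebra L
  open Order.Lattice
    (LatticeProperties.∨-∧-orderTheoreticLattice
      (DistributiveLattice.lattice distributiveLattice))
    using (x≤x∨y; y≤x∨y; ∨-least; x∧y≤x; x∧y≤y; ∧-greatest)
    renaming (refl to ≤-refl; trans to ≤-trans; reflexive to ≤-reflexive; antisym to ≤-antisym)

  -- Inequalities for `*`, `′` and their composite.

  ∧-mono : ∀ {w x y z} → w ≤ x → y ≤ z → w ∧ y ≤ x ∧ z
  ∧-mono w≤x y≤z = ∧-greatest (≤-trans (x∧y≤x _ _) w≤x) (≤-trans (x∧y≤y _ _) y≤z)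

  0-least : ∀ x → 0# ≤ x
  0-least x = ≤-trans (x≤x∨y 0# x) (≤-reflexive (0-identityˡ x))

  1-greatest : ∀ x → x ≤ 1#
  1-greatest x = ≤-trans (≤-reflexive (sym (1-identityˡ x))) (x∧y≤x 1# x)

  ≤0⇒≈0 : ∀ {x} → x ≤ 0# → x ≈ 0#
  ≤0⇒≈0 x≤0 = ≤-antisym x≤0 (0-least _)

  disjoint⇒≤* : ∀ {x y} → x ∧ y ≤ 0# → y ≤ x *
  disjoint⇒≤* = Equivalence.to (*-pseudocomplement _ _) ∘ ≤0⇒≈0

  ≤*⇒disjoint : ∀ {x y} → y ≤ x * → x ∧ y ≤ 0#
  ≤*⇒disjoint = ≤-reflexive ∘ Equivalence.from (*-pseudocomplement _ _)

  x∧x*≤0 : ∀ x → x ∧ x * ≤ 0#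
  x∧x*≤0 x = ≤*⇒disjoint ≤-refl

  *-antitone : ∀ {x y} → x ≤ y → y * ≤ x *
  *-antitone x≤y = disjoint⇒≤* (≤-trans (∧-mono x≤y ≤-refl) (x∧x*≤0 _))

  x≤x** : ∀ x → x ≤ x * *
  x≤x** x = disjoint⇒≤* (≤-trans (≤-reflexive (∧-comm _ _)) (x∧x*≤0 x))

  ′-antitone : ∀ {x y} → x ≤ y → y ′ ≤ x ′
  ′-antitone {x} {y} x≤y =
    ≤-trans (y≤x∨y (x ′) (y ′))
      (≤-reflexive (trans (sym (′-deMorgan x y)) (′-cong (sym x≤y))))

  x′′≤x : ∀ x → x ′ ′ ≤ x
  x′′≤x x = ≤-reflexive (′-involutive x)

  x≤x′′ : ∀ x → x ≤ x ′ ′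
  x≤x′′ x = ≤-reflexive (sym (′-involutive x))

  1≤0′ : 1# ≤ 0# ′
  1≤0′ = ≤-trans (x≤x′′ 1#) (′-antitone (0-least (1# ′)))

  -- The image of `x ′ ∧ x ′ * ≤ 0#` under `′`.
  1≤x∨x′*′ : ∀ x → 1# ≤ x ∨ x ′ * ′
  1≤x∨x′*′ x =
    ≤-trans 1≤0′
      (≤-trans (′-antitone (x∧x*≤0 (x ′)))
        (≤-reflexive (trans (′-deMorgan _ _) (∨-cong (′-involutive x) refl))))

  ′*-mono : ∀ {x y} → x ≤ y → x ′ * ≤ y ′ *
  ′*-mono = *-antitone ∘ ′-antitone

  ′*-∧ : ∀ x y → x ′ * ∧ y ′ * ≤ (x ∧ y) ′ *
  ′*-∧ x y = disjoint⇒≤*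
    (≤-trans (≤-reflexive (trans (∧-cong (′-deMorgan x y) refl) (∧-distribʳ-∨ _ _ _)))
      (∨-least
        (≤-trans (∧-mono ≤-refl (x∧y≤x _ _)) (x∧x*≤0 (x ′)))
        (≤-trans (∧-mono ≤-refl (x∧y≤y _ _)) (x∧x*≤0 (y ′)))))

  1≤1′* : 1# ≤ 1# ′ *
  1≤1′* = disjoint⇒≤*
    (≤-trans (x∧y≤x _ _) (≤-trans (′-antitone (1-greatest (0# ′))) (x′′≤x 0#)))

  -- The left side is disjoint from `x ′ * ′`, so `1≤x∨x′*′` and distributivity leave it below `x`.
  x′*′*≤x : ∀ x → x ′ * ′ * ≤ x
  x′*′*≤x x =
    ≤-trans (∧-greatest ≤-refl (≤-trans (1-greatest _) (1≤x∨x′*′ x)))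
      (≤-trans (≤-reflexive (∧-distribˡ-∨ _ _ _))
        (∨-least (x∧y≤y _ _)
          (≤-trans (≤-reflexive (∧-comm _ _)) (≤-trans (x∧x*≤0 _) (0-least x)))))

  -- Iterates of `′*` and finite range.

  iter-mono : ∀ k {x y} → x ≤ y → iter k x ≤ iter k y
  iter-mono ℕ.zero    = id
  iter-mono (ℕ.suc k) = ′*-mono ∘ iter-mono k

  iter-∧ : ∀ k x y → iter k x ∧ iter k y ≤ iter k (x ∧ y)
  iter-∧ ℕ.zero    x y = ≤-refl
  iter-∧ (ℕ.suc k) x y = ≤-trans (′*-∧ _ _) (′*-mono (iter-∧ k x y))

  1≤iter-1 : ∀ k → 1# ≤ iter k 1#
  1≤iter-1 ℕ.zero    = ≤-refl
  1≤iter-1 (ℕ.suc k) = ≤-trans 1≤1′* (′*-mono (1≤iter-1 k))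

  iter-shift : ∀ k x → iter k (x ′ *) ≡ iter (ℕ.suc k) x
  iter-shift ℕ.zero    x = ≡-refl
  iter-shift (ℕ.suc k) x = cong (λ y → y ′ *) (iter-shift k x)

  -- The element in the range condition. Its iterates decrease, whereas those of a general `x` can
  -- alternate.
  contract : Carrier → Carrier
  contract x = x ∧ x ′ *

  iter-contract-decreasing : ∀ k j x → iter (j ℕ.+ k) (contract x) ≤ iter k (contract x)
  iter-contract-decreasing k ℕ.zero    x = ≤-refl
  iter-contract-decreasing k (ℕ.suc j) x =
    ≤-trans (step (j ℕ.+ k)) (iter-contract-decreasing k j x)
    where
    contract-′* : contract x ′ * ≤ contract x
    contract-′* = ∧-greatest
      (≤-trans (′*-mono (x∧y≤y _ _)) (x′*′*≤x x))
      (′*-mono (x∧y≤x _ _))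

    step : ∀ m → iter (ℕ.suc m) (contract x) ≤ iter m (contract x)
    step m = subst (_≤ iter m (contract x)) (iter-shift m (contract x)) (iter-mono m contract-′*)

  iter-stable : ∀ n → HasRange n → ∀ j x → iter n (contract x) ≤ iter (j ℕ.+ n) (contract x)
  iter-stable n range ℕ.zero    x = ≤-refl
  iter-stable n range (ℕ.suc j) x =
    ≤-trans (≤-reflexive (range x)) (′*-mono (iter-stable n range j x))

  -- Stability leads from `n` to `k + n`, and descent from there to `k`, so `k` and `n` need no
  -- comparison.
  range-bound : ∀ n → HasRange n → ∀ k x →
                iter n x ∧ iter (ℕ.suc n) x ≤ iter k (contract x)
  range-bound n range k x =
    ≤-trans (subst (λ y → iter n x ∧ y ≤ iter n (contract x)) (iter-shift n x) (iter-∧ n x (x ′ *)))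
      (≤-trans (iter-stable n range k x)
        (subst (λ m → iter m (contract x) ≤ iter k (contract x)) (+-comm n k)
          (iter-contract-decreasing k n x)))

  -- Paths between prime ideals.

  open module Ideal = PrimeIdeal {L = L}

  _∼_ : PrimeIdeal L → PrimeIdeal L → Set (suc (c ⊔ ℓ))
  _∼_ = EqClosure (Poset._≤_ (inclusionPoset L))

  ∼-sym : ∀ {I J} → I ∼ J → J ∼ I
  ∼-sym = symmetric _

  -- The relation J ⊑ₖ I, with `I` written first.
  Reach : ℕ → PrimeIdeal L → PrimeIdeal L → Set (c ⊔ ℓ)
  Reach k I J = ∀ {a} → a ∈ ⟦ J ⟧ → iter k a ∈ ⟦ I ⟧

  reach-up : ∀ {k I J K} → Reach k I J → ⟦ J ⟧ ⊆ ⟦ K ⟧ → Reach (2 ℕ.+ k) I K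
  reach-up {k} {I} {J} {K} reach J⊆K {a} a∈K =
    subst (_∈ ⟦ I ⟧) shift (reach a′*′*∈J)
    where
    shift : iter k (a ′ * ′ *) ≡ iter (2 ℕ.+ k) a
    shift rewrite iter-shift k (a ′ *) = cong (λ y → y ′ *) (iter-shift k a)

    a′*′*∈J : a ′ * ′ * ∈ ⟦ J ⟧
    a′*′*∈J =
      -- By primality `J` contains `a ′ * ′` or its pseudocomplement; the former would put `1#` into
      -- `K`.
      [ (λ a′*′∈J → ⊥-elim (1∉ K (down K (1≤x∨x′*′ a) (∨-closed K a∈K (J⊆K a′*′∈J)))))
      , id
      ]′ (prime J (down J (x∧x*≤0 (a ′ * ′)) (0∈ J)))

  ∼⇒reach : ∀ {I J} → I ∼ J → ∃ λ k → Reach k I J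
  ∼⇒reach {I} = go 0 id
    where
    go : ∀ k {J K} → Reach k I J → J ∼ K → ∃ λ m → Reach m I K
    go k reach ε = k , reach
    go k {J} reach (_◅_ {j = M} (fwd J⊆M) path) =
      go (2 ℕ.+ k) {M} (reach-up {k} {I} {J} {M} reach J⊆M) path
    go k reach (_◅_ {j = M} (bwd M⊆J) path) = go k {M} (λ a∈M → reach (M⊆J a∈M)) path

  -- Apply `range-bound` to `a ∨ b` and use primality of `I`. Since `a` and `b` are independent,
  -- failures of `Reach n` and `Reach (n + 1)` at different elements are already contradictory.
  reach-bounded : ∀ n → HasRange n → ∀ k I J → Reach k I J →
                  ∀ {a b} → a ∈ ⟦ J ⟧ → b ∈ ⟦ J ⟧ →
                  iter n a ∈ ⟦ I ⟧ ⊎ iter (ℕ.suc n) b ∈ ⟦ I ⟧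
  reach-bounded n range k I J reach {a} {b} a∈J b∈J =
    Sum.map (down I (iter-mono n (x≤x∨y a b)))
            (down I (iter-mono (ℕ.suc n) (y≤x∨y a b)))
      (prime I (down I (range-bound n range k (a ∨ b))
        (reach (down J (x∧y≤x _ _) (∨-closed J a∈J b∈J)))))

  -- The prime ideal theorem from Zorn's lemma.

  record AvoidingIdeal (F : Pred Carrier (c ⊔ ℓ)) : Set (suc (c ⊔ ℓ)) where
    field
      members    : Pred Carrier (c ⊔ ℓ)
      0∈m        : 0# ∈ members
      down-m     : ∀ {x y} → x ≤ y → y ∈ members → x ∈ members
      ∨-closed-m : ∀ {x y} → x ∈ members → y ∈ members → x ∨ y ∈ members
      avoids     : ∀ {x} → x ∈ F → x ∉ members

  open AvoidingIdeal

  avoidingPoset : Pred Carrier (c ⊔ ℓ) → Poset (suc (c ⊔ ℓ)) (c ⊔ ℓ) (c ⊔ ℓ)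
  avoidingPoset F = record
    { Carrier        = AvoidingIdeal F
    ; _≈_            = λ I J → members I ⊆ members J × members J ⊆ members I
    ; _≤_            = λ I J → members I ⊆ members J
    ; isPartialOrder = record
      { isPreorder = record
        { isEquivalence = record
          { refl  = id , id
          ; sym   = λ (f , g) → g , f
          ; trans = λ (f , g) (f′ , g′) → (λ z → f′ (f z)) , (λ z → g (g′ z))
          }
        ; reflexive = proj₁
        ; trans     = λ f g z → g (f z)
        }
      ; antisym = _,_
      }
    }

  -- Bounds the empty chain.
  zeroIdeal : ∀ {F} → 0# ∉ F → (∀ {x y} → x ≈ y → x ∈ F → y ∈ F) → AvoidingIdeal F
  zeroIdeal {F} 0∉F resp = record
    { members    = λ x → Level.Lift c (x ≤ 0#)
    ; 0∈m        = Level.lift ≤-refl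
    ; down-m     = λ x≤y (Level.lift y≤0) → Level.lift (≤-trans x≤y y≤0)
    ; ∨-closed-m = λ (Level.lift x≤0) (Level.lift y≤0) → Level.lift (∨-least x≤0 y≤0)
    ; avoids     = λ x∈F (Level.lift x≤0) → 0∉F (resp (≤0⇒≈0 x≤0) x∈F)
    }

  adjoin : ∀ {F} (I : AvoidingIdeal F) x →
           (∀ {z i} → z ∈ F → i ∈ members I → ¬ (z ≤ i ∨ x)) → AvoidingIdeal F
  adjoin I x avoid = record
    { members    = λ z → ∃ λ i → i ∈ members I × z ≤ i ∨ x
    ; 0∈m        = 0# , 0∈m I , 0-least _
    ; down-m     = λ z≤w (i , i∈I , w≤) → i , i∈I , ≤-trans z≤w w≤
    ; ∨-closed-m = λ (i , i∈I , z≤) (j , j∈I , w≤) →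
        i ∨ j , ∨-closed-m I i∈I j∈I ,
        ∨-least
          (≤-trans z≤ (∨-least (≤-trans (x≤x∨y i j) (x≤x∨y _ x)) (y≤x∨y _ x)))
          (≤-trans w≤ (∨-least (≤-trans (y≤x∨y i j) (x≤x∨y _ x)) (y≤x∨y _ x)))
    ; avoids     = λ z∈F (i , i∈I , z≤) → avoid z∈F i∈I z≤
    }

  module _ (em : ∀ a → ExcludedMiddle a) where

    stable : ∀ {a} {P : Set a} → ¬ ¬ P → P
    stable = decidable-stable (em _)

    ζ : PrimeIdeal L → PrimeIdeal L
    ζ = involute L (em (c ⊔ ℓ))

    ζ-∼ : ∀ {I J} → I ∼ J → ζ I ∼ ζ J
    ζ-∼ = Star.gmap ζ λ where
      (fwd I⊆J) → bwd (λ x′∉J x′∈I → x′∉J (I⊆J x′∈I))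
      (bwd J⊆I) → fwd (λ x′∉I x′∈J → x′∉I (J⊆I x′∈J))

    -- The union of a chain quantifies over ideals, so it lives one universe too
    -- high; excluded middle brings membership in it back down.
    Resize : ∀ {p} q → Set p → Set q
    Resize {p} q P with em p {P}
    ... | yes _ = ⊤
    ... | no  _ = ⊥

    resize : ∀ {p q} {P : Set p} → P → Resize q P
    resize {p} {P = P} x with em p {P}
    ... | yes _  = _
    ... | no  ¬P = ⊥-elim (¬P x)

    unresize : ∀ {p q} {P : Set p} → Resize q P → P
    unresize {p} {P = P} r with em p {P}
    unresize r  | yes x = x
    unresize () | no  _

    module _ {F : Pred Carrier (c ⊔ ℓ)} where

      chainUnion : ∀ {s} (C : Pred (AvoidingIdeal F) s) →
                   (∀ {I J} → I ∈ C → J ∈ C → members I ⊆ members J ⊎ members J ⊆ members I) →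
                   ∃ (_∈ C) → AvoidingIdeal F
      chainUnion {s} C chain (I₀ , I₀∈C) = record
        { members    = λ x → Resize (c ⊔ ℓ) (InSome x)
        ; 0∈m        = resize (I₀ , I₀∈C , 0∈m I₀)
        ; down-m     = λ x≤y y∈ → let I , I∈C , y∈I = unresize y∈ in
                                  resize (I , I∈C , down-m I x≤y y∈I)
        ; ∨-closed-m = λ x∈ y∈ → resize (join (unresize x∈) (unresize y∈))
        ; avoids     = λ x∈F x∈ → let I , _ , x∈I = unresize x∈ in avoids I x∈F x∈I
        }
        where
        InSome : Carrier → Set (suc (c ⊔ ℓ) ⊔ s)
        InSome x = ∃ λ I → I ∈ C × x ∈ members I

        join : ∀ {x y} → InSome x → InSome y → InSome (x ∨ y)
        join (I , I∈C , x∈I) (J , J∈C , y∈J) with chain I∈C J∈C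
        ... | inj₁ I⊆J = J , J∈C , ∨-closed-m J (I⊆J x∈I) y∈J
        ... | inj₂ J⊆I = I , I∈C , ∨-closed-m I x∈I (J⊆I y∈J)

      chainBound : AvoidingIdeal F → ∀ {s} (C : Pred (AvoidingIdeal F) s) →
                   (∀ {I J} → I ∈ C → J ∈ C → members I ⊆ members J ⊎ members J ⊆ members I) →
                   ∃ λ U → ∀ {I} → I ∈ C → members I ⊆ members U
      chainBound Z C chain with em _ {∃ (_∈ C)}
      ... | yes C≠∅ = chainUnion C chain C≠∅ , λ I∈C x∈I → resize (_ , I∈C , x∈I)
      ... | no  C≡∅ = Z , λ I∈C → ⊥-elim (C≡∅ (_ , I∈C))

      -- If neither `x` nor `y` is in `m`, adjoining either one meets `F`, say in `z ≤ i ∨ x` and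
      -- `w ≤ j ∨ y`. Then `z ∧ w ≤ (i ∨ j) ∨ (x ∧ y)` lies in both `F` and `m`.
      maximal⇒prime : (∀ {x y} → x ∈ F → y ∈ F → x ∧ y ∈ F) →
                      (m : AvoidingIdeal F) →
                      (∀ I → members m ⊆ members I → members I ⊆ members m) →
                      ∀ {x y} → x ∧ y ∈ members m → x ∈ members m ⊎ y ∈ members m
      maximal⇒prime ∧-closed m maximal {x} {y} xy∈m with em _ {x ∈ members m} | em _ {y ∈ members m}
      ... | yes x∈m | _       = inj₁ x∈m
      ... | no  _   | yes y∈m = inj₂ y∈m
      ... | no  x∉m | no  y∉m = ⊥-elim
        (meets x x∉m λ {z} {i} z∈F i∈m z≤ →
         meets y y∉m λ {w} {j} w∈F j∈m w≤ →
         avoids m (∧-closed z∈F w∈F)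
           (down-m m
             (≤-trans
               (∧-mono
                 (≤-trans z≤ (∨-least (≤-trans (x≤x∨y i j) (x≤x∨y _ x)) (y≤x∨y _ x)))
                 (≤-trans w≤ (∨-least (≤-trans (y≤x∨y i j) (x≤x∨y _ y)) (y≤x∨y _ y))))
               (≤-reflexive (sym (∨-distribˡ-∧ (i ∨ j) x y))))
             (∨-closed-m m (∨-closed-m m i∈m j∈m) xy∈m)))
        where
        meets : ∀ v → v ∉ members m → ¬ (∀ {z i} → z ∈ F → i ∈ members m → ¬ (z ≤ i ∨ v))
        meets v v∉m avoid = v∉m (maximal (adjoin m v avoid)
          (λ {i} i∈m → i , i∈m , x≤x∨y i v)
          (0# , 0∈m m , y≤x∨y 0# v))

      module _ (zorn : ∀ a ℓ₁ ℓ₂ s → ZornsLemma a ℓ₁ ℓ₂ s) where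

        primeIdealTheorem : 1# ∈ F → 0# ∉ F →
                            (∀ {x y} → x ≈ y → x ∈ F → y ∈ F) →
                            (∀ {x y} → x ∈ F → y ∈ F → x ∧ y ∈ F) →
                            ∃ λ M → ∀ {x} → x ∈ F → x ∉ ⟦ M ⟧
        primeIdealTheorem 1∈F 0∉F resp ∧-closed
          with m , maximal ← zorn _ _ _ (c ⊔ ℓ) (avoidingPoset F) (chainBound (zeroIdeal 0∉F resp))
          = record
            { ⟦_⟧      = members m
            ; 0∈       = 0∈m m
            ; 1∉       = avoids m 1∈F
            ; down     = down-m m
            ; ∨-closed = ∨-closed-m m
            ; prime    = maximal⇒prime ∧-closed m (λ I m⊆I → proj₂ (maximal {I} m⊆I))
            } , avoids m

    -- From reachability back to paths.

    module _ (zorn : ∀ a ℓ₁ ℓ₂ s → ZornsLemma a ℓ₁ ℓ₂ s) where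

      -- The filter generated by `G` and the complement of `N` is proper, since `a ∧ b ≤ 0#` gives
      -- `b ≤ a *` with `a *` in `N`. A prime ideal disjoint from it misses `G` and lies inside `N`.
      prime-below : (G : Pred Carrier (c ⊔ ℓ)) → 1# ∈ G →
                    (∀ {x y} → x ∈ G → y ∈ G → x ∧ y ∈ G) →
                    ∀ N → (∀ {x} → x ∈ G → x * ∈ ⟦ N ⟧) →
                    ∃ λ M → ⟦ M ⟧ ⊆ ⟦ N ⟧ × (∀ {x} → x ∈ G → x ∉ ⟦ M ⟧)
      prime-below G 1∈G ∧-closed N G*⊆N =
        M ,
        (λ {b} b∈M → stable λ b∉N → avoid (1# , b , 1∈G , b∉N , x∧y≤y _ _) b∈M) ,
        (λ {a} a∈G → avoid (a , 1# , a∈G , 1∉ N , x∧y≤x _ _))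
        where
        F : Pred Carrier (c ⊔ ℓ)
        F z = ∃ λ a → ∃ λ b → a ∈ G × b ∉ ⟦ N ⟧ × a ∧ b ≤ z

        F-∧-closed : ∀ {z w} → z ∈ F → w ∈ F → z ∧ w ∈ F
        F-∧-closed (a , b , a∈G , b∉N , ab≤z) (d , e , d∈G , e∉N , de≤w) =
          a ∧ d , b ∧ e , ∧-closed a∈G d∈G , [ b∉N , e∉N ]′ ∘ prime N ,
          ∧-greatest
            (≤-trans (∧-mono (x∧y≤x _ _) (x∧y≤x _ _)) ab≤z)
            (≤-trans (∧-mono (x∧y≤y _ _) (x∧y≤y _ _)) de≤w)

        separation : ∃ λ M → ∀ {x} → x ∈ F → x ∉ ⟦ M ⟧
        separation = primeIdealTheorem zorn
          (1# , 1# , 1∈G , 1∉ N , x∧y≤x _ _)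
          (λ (_ , _ , a∈G , b∉N , ab≤0) → b∉N (down N (disjoint⇒≤* ab≤0) (G*⊆N a∈G)))
          (λ z≈w (a , b , a∈G , b∉N , ab≤z) →
             a , b , a∈G , b∉N , ≤-trans ab≤z (≤-reflexive z≈w))
          F-∧-closed

        M     = proj₁ separation
        avoid = proj₂ separation

      -- For the chosen `G`, a prime ideal misses `G` exactly when it satisfies `Reach k I`.
      reach-pred : ∀ {k I J} → Reach (ℕ.suc k) I J → ∃ λ M → ⟦ M ⟧ ⊆ ⟦ ζ J ⟧ × Reach k I M
      reach-pred {k} {I} {J} reach
        with M , M⊆ζJ , avoid ← prime-below (λ a → iter k a ∉ ⟦ I ⟧)
          (λ 1∈I → 1∉ I (down I (1≤iter-1 k) 1∈I))
          (λ {x} {y} x∉ y∉ xy∈ → [ x∉ , y∉ ]′ (prime I (down I (iter-∧ k x y) xy∈)))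
          (ζ J)
          -- As `a ≤ a * * ≈ a * ′ ′ *`, the element `iter k a` lies below `iter (k + 1) (a * ′)`,
          -- which is in `I` once `a * ′` is in `J`.
          (λ {a} a∉ a*′∈J → a∉ (down I
            (≤-trans (iter-mono k (≤-trans (x≤x** a) (*-antitone (x′′≤x (a *)))))
              (subst (_≤ iter (ℕ.suc k) (a * ′)) (≡-sym (iter-shift k (a * ′))) ≤-refl))
            (reach a*′∈J)))
        = M , M⊆ζJ , λ a∈M → stable λ a∉ → avoid a∉ a∈M

      -- Comparing two ideals avoids naming ζᵏ(I). Both lie below `I` when `k` is zero; otherwise
      -- `ζ` carries the path between their predecessors `M` and `N` to one from `ζ M` to `ζ N`, and
      -- `M ⊆ ζ J` means `J ⊆ ζ M`.
      reach-∼ : ∀ k I J K → Reach k I J → Reach k I K → J ∼ K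
      reach-∼ ℕ.zero I J K J⊆I K⊆I = fwd {b = I} J⊆I ◅ bwd K⊆I ◅ ε
      reach-∼ (ℕ.suc k) I J K reachJ reachK
        with M , M⊆ζJ , reachM ← reach-pred {k} {I} {J} reachJ
           | N , N⊆ζK , reachN ← reach-pred {k} {I} {K} reachK
        = up J M M⊆ζJ ◅◅ ζ-∼ (reach-∼ k I M N reachM reachN) ◅◅ ∼-sym (up K N N⊆ζK)
        where
        up : ∀ J M → ⟦ M ⟧ ⊆ ⟦ ζ J ⟧ → J ∼ ζ M
        up J M M⊆ζJ = fwd (λ {x} x∈J x′∈M → M⊆ζJ x′∈M (down J (x′′≤x x) x∈J)) ◅ ε

      -- Separating a point from a component.

      class-closed : ∀ n → HasRange n → ∀ I K → ¬ (I ∼ K) →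
                     ∃ λ a → ∃ λ b → a ∈ ⟦ K ⟧ × b ∈ ⟦ K ⟧ ×
                       (∀ J → a ∈ ⟦ J ⟧ → b ∈ ⟦ J ⟧ → ¬ (I ∼ J))
      class-closed n range I K I≁K =
        let a , a∈K , sepₐ = separate n
            b , b∈K , sepᵦ = separate (ℕ.suc n)
        in a , b , a∈K , b∈K , λ J a∈J b∈J I∼J →
          let k , reach = ∼⇒reach I∼J in
          -- If some `x` violated `Reach n I J`, `reach-bounded` would force `Reach (n + 1) I J`,
          -- contrary to `sepᵦ`. So `Reach n I J` holds, contrary to `sepₐ`.
          sepₐ J I∼J a∈J λ x∈J → stable λ x∉ →
          sepᵦ J I∼J b∈J λ y∈J → stable λ y∉ →
          [ x∉ , y∉ ]′ (reach-bounded n range k I J reach x∈J y∈J)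
        where
        separate : ∀ j → ∃ λ a → a ∈ ⟦ K ⟧ × (∀ J → I ∼ J → a ∈ ⟦ J ⟧ → ¬ Reach j I J)
        separate j with em _ {∃ λ a → a ∈ ⟦ K ⟧ × iter j a ∉ ⟦ I ⟧}
        ... | yes (a , a∈K , a∉) = a , a∈K , λ _ _ a∈J reach → a∉ (reach a∈J)
        -- Now `Reach j I K` holds, so no ideal joined to `I` is reached at `j`. Any member of `K`
        -- will do, and `0#` is always one.
        ... | no  none = 0# , 0∈ K , λ J I∼J _ reach →
          I≁K (I∼J ◅◅ reach-∼ j I J K reach (λ x∈K → stable λ x∉ → none (_ , x∈K , x∉)))

theorem4p1 : (em : ∀ a → ExcludedMiddle a) →
    (zorn : ∀ a ℓ₁ ℓ₂ s → ZornsLemma a ℓ₁ ℓ₂ s) →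
    ∀ {c ℓ} (n : ℕ) (L : PMAlgebra c ℓ) → L ∈𝐌 n →
    let open InvolutiveOrderedSpace (dualSpace L (em (c ⊔ ℓ))) in
    (S : Pred Point (suc (c ⊔ ℓ))) → IsOrderComponent S → Closed S
theorem4p1 em zorn {c} {ℓ} n L (_ , range) S (joined , maximal) {K} K∉S
  with em _ {∃ λ I → I ∈ S}
-- The empty intersection, the whole space, misses an empty `S`.
... | no  S≡∅ = [] , [] , λ _ J∈S → S≡∅ (_ , J∈S)
... | yes (I , I∈S)
  with a , b , a∈K , b∈K , separated ← class-closed L em zorn n range I K
    -- The class of `I` is pairwise joined and contains `S`, so maximality would put `K` into `S`.
    (λ I∼K → K∉S (maximal (λ J → _∼_ L I J)
      (λ J∈S → joined I∈S J∈S)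
      (λ I∼J I∼J′ → ∼-sym L I∼J ◅◅ I∼J′)
      I∼K))
  = inj₁ a ∷ inj₁ b ∷ [] , a∈K ∷ b∈K ∷ [] ,
    λ { {J} (a∈J ∷ b∈J ∷ []) J∈S → separated J a∈J b∈J (joined I∈S J∈S) }
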